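{- Let $n_0$ be a positive integer and let $(f_n)_{n\ge n_0}$ be a nondecreasing sequence of positive integers such that $f_{n_0}=1$, \[\sum_{n=n_0}^\infty\frac{f_n}{2^n}\le\frac{1}{4},\] and the sequence $\left(\frac{f_n}{2^n}\right)_{n\ge n_0}$ is nonincreasing (so that $f_n\le f_{n+1}\le 2f_n$ for all $n\ge n_0$). Then there exists an antichain $\mathcal{F}$ of finite subsets of $\mathbb{N}$ such that \[ |\mathcal{F}\cap 2^{[n]}| \ge f_n \] for all $n\ge n_0$.
   Context: $\mathbb{N}=\{1,2,3,\dots\}$, $[n]=\{1,\dots,n\}$, and $2^{X}$ denotes the power set of $X$; thus $\mathcal{F}\cap 2^{[n]}$ is the set of members of $\mathcal{F}$ contained in $[n]$. A family $\mathcal{F}$ of sets is an antichain if $A\not\subseteq B$ for all distinct $A,B\in\mathcal{F}$. -}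

module Defs where

open import Data.Nat using (ℕ; zero; suc; _+_; _≤_; _<_)
open import Data.Integer using (+_)
open import Data.Rational using (ℚ; _/_; ½; 0ℚ; 1ℚ)
import Data.Rational as ℚ
open import Data.List using (List; length)
open import Data.List.Relation.Unary.All using (All)
open import Data.List.Relation.Unary.AllPairs using (AllPairs)
open import Data.List.Relation.Unary.Unique.Propositional using (Unique)
open import Data.List.Relation.Binary.Subset.Propositional using (_⊆_)
open import Data.Product using (_×_; ∃)
open import Relation.Binary.PropositionalEquality using (_≡_)

half^ : ℕ → ℚ
half^ zero    = 1ℚ
half^ (suc n) = ½ ℚ.* half^ n

term : (ℕ → ℕ) → ℕ → ℚ
term f n = ((+ f n) / 1) ℚ.* half^ n

partialSum : (ℕ → ℚ) → ℕ → ℕ → ℚ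
partialSum a m zero    = 0ℚ
partialSum a m (suc k) = a (m + k) ℚ.+ partialSum a m k

-- A finite subset of ℕ = {1,2,3,...} is represented canonically by the
-- strictly increasing list of its elements, all of which are ≥ 1.
IsFinSubset : List ℕ → Set
IsFinSubset xs = AllPairs _<_ xs × All (1 ≤_) xs

InRange : ℕ → List ℕ → Set
InRange n xs = All (λ x → 1 ≤ x × x ≤ n) xs

Family : Set₁
Family = List ℕ → Set

WellFormed : Family → Set
WellFormed F = ∀ A → F A → IsFinSubset A

Antichain : Family → Set
Antichain F = ∀ A B → F A → F B → A ⊆ B → A ≡ B

AtLeast : Family → ℕ → ℕ → Set
AtLeast F n k = ∃ λ (L : List (List ℕ)) →
  Unique L × length L ≡ k × All (λ A → F A × InRange n A) L

{-# OPTIONS --safe #-}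
-- Attach to every i ≥ 1 a weight w i = 2^(- b i), and let 𝓕 consist of the finite
-- sets of total weight 1; this is an antichain because the weights are positive.
-- Every i is either a "digit" or "free", and b i is the number of digits in [i].  The
-- digits thus have weights 1/2, 1/4, 1/8, …, so a set of free elements of [n], of
-- weight s ∈ (0,1], is completed to a member of 𝓕 by the digits of the binary
-- expansion of 1 - s, which lie in [n].  If [n] has k n free elements, of total weight
-- at most 1, this gives 2^(k n) - 1 members of 𝓕 inside [n].
-- Now make n + 1 free iff n + 1 ≥ n₀ and 2^(k n) ≤ f (n + 1).  Then f n < 2^(k n) for
-- n ≥ n₀, and a free n + 1 has weight 2^(k n - n) ≤ 2 f (n + 1) / 2^(n + 1), so
-- that the total weight of the free elements is at most 2 · 1/4.
module Submission where

open import Defs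
open import Data.Nat using (ℕ; suc; _≤_)
open import Data.Integer using (+_)
open import Data.Rational using (_/_)
import Data.Rational as ℚ
open import Data.Product using (Σ; _×_)
open import Relation.Binary.PropositionalEquality using (_≡_)

open import Data.Nat using (zero; _+_; _*_; _∸_; _^_; _<_; z≤n; s≤s; _≤?_)
import Data.Nat.Properties as ℕₚ
open import Data.Nat.Solver using (module +-*-Solver)
import Data.Nat.Coprimality as Coprime
import Data.Integer as ℤ
import Data.Integer.Properties as ℤₚ
open import Data.Rational using (ℚ; mkℚ; ½; 0ℚ; 1ℚ)
import Data.Rational.Properties as ℚₚ
import Data.Rational.Solver as ℚSolver
open import Data.Bool using (Bool; true; false; if_then_else_)
open import Data.List using (List; []; _∷_; _∷ʳ_; _++_; map; take; length)
import Data.List.Properties as Listₚ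
open import Data.List.Membership.Propositional using (_∈_)
import Data.List.Membership.Propositional.Properties as ∈ₚ
open import Data.List.Relation.Binary.Disjoint.Propositional using (Disjoint)
open import Data.List.Relation.Unary.Any using (here; there)
open import Data.List.Relation.Unary.All as All using (All; []; _∷_)
import Data.List.Relation.Unary.All.Properties as Allₚ
open import Data.List.Relation.Unary.AllPairs using ([]; _∷_)
import Data.List.Relation.Unary.AllPairs.Properties as AllPairsₚ
import Data.List.Relation.Unary.Unique.Propositional.Properties as Uniqueₚ
open import Data.List.Relation.Binary.Subset.Propositional using (_⊆_)
open import Data.Product using (_,_; ∃; proj₁; proj₂)
open import Data.Sum as Sum using (_⊎_; inj₁; inj₂; [_,_]′)
open import Function using (_∘_; id)
open import Relation.Binary using (tri<; tri≈; tri>)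
open import Relation.Nullary using (yes; no; does; contradiction)
open import Relation.Nullary.Decidable using (dec-true; dec-false)
open import Relation.Binary.PropositionalEquality
  using (refl; sym; trans; cong; cong₂; subst; module ≡-Reasoning)

-- Dyadic rationals `n / 2^e`.

ι : ℕ → ℚ
ι n = + n / 1

-- The gcd inside `_/_` is stuck on a variable; this normal form lets sums and comparisons in ℚ
-- unfold.
ι≡mkℚ : ∀ n → ι n ≡ mkℚ (+ n) 0 (Coprime.sym (Coprime.1-coprimeTo n))
ι≡mkℚ n = ℚₚ.normalize-coprime (Coprime.sym (Coprime.1-coprimeTo n))

ι-+ : ∀ m n → ι (m + n) ≡ ι m ℚ.+ ι n
ι-+ m n = begin
  ι (m + n)                                ≡⟨ cong (_/ 1) (cong₂ ℤ._+_ (ℤₚ.*-identityʳ (+ m)) (ℤₚ.*-identityʳ (+ n))) ⟨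
  (+ m ℤ.* + 1 ℤ.+ + n ℤ.* + 1) / 1        ≡⟨ cong₂ ℚ._+_ (ι≡mkℚ m) (ι≡mkℚ n) ⟨
  ι m ℚ.+ ι n                              ∎
  where open ≡-Reasoning

ι-cancel-≤ : ∀ {m n} → ι m ℚ.≤ ι n → m ≤ n
ι-cancel-≤ {m} {n} m≤n rewrite ι≡mkℚ m | ι≡mkℚ n =
  ℤₚ.drop‿+≤+ (ℤₚ.*-cancelʳ-≤-pos (+ m) (+ n) (+ 1) (ℚₚ.drop-*≤* m≤n))

half^-positive : ∀ n → ℚ.Positive (half^ n)
half^-positive zero    = _
half^-positive (suc n) = ℚₚ.pos*pos⇒pos ½ (half^ n) {{half^-positive n}}

-- Opaque, since unfolding ι runs the gcd normalisation of _/_ on variables.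
opaque

  scaled : ℕ → ℕ → ℚ
  scaled n e = ι n ℚ.* half^ e

  scaled-0 : ∀ e → scaled 0 e ≡ 0ℚ
  scaled-0 e = ℚₚ.*-zeroˡ (half^ e)

  scaled-term : ∀ f n → scaled (f n) n ≡ term f n
  scaled-term f n = refl

  scaled-cancel-≤ : ∀ {m n} e → scaled m e ℚ.≤ scaled n e → m ≤ n
  scaled-cancel-≤ e = ι-cancel-≤ ∘ ℚₚ.*-cancelʳ-≤-pos (half^ e) {{half^-positive e}}

  scaled-+ : ∀ m n e → scaled (m + n) e ≡ scaled m e ℚ.+ scaled n e
  scaled-+ m n e = trans (cong (ℚ._* half^ e) (ι-+ m n)) (ℚₚ.*-distribʳ-+ (half^ e) (ι m) (ι n))

  scaled-1 : ∀ e → scaled 1 e ≡ half^ e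
  scaled-1 e = ℚₚ.*-identityˡ (half^ e)

  scaled-double : ∀ n e → scaled (n + n) (suc e) ≡ scaled n e
  scaled-double n e = begin
    ι (n + n) ℚ.* (½ ℚ.* half^ e)            ≡⟨ cong (ℚ._* (½ ℚ.* half^ e)) (ι-+ n n) ⟩
    (ι n ℚ.+ ι n) ℚ.* (½ ℚ.* half^ e)        ≡⟨ solve 2 (λ x h → (x :+ x) :* (con ½ :* h) := x :* h) refl (ι n) (half^ e) ⟩
    ι n ℚ.* half^ e                          ∎
    where open ≡-Reasoning
          open ℚSolver.+-*-Solver

scaled-suc : ∀ n e → scaled (suc n) e ≡ scaled n e ℚ.+ half^ e
scaled-suc n e = begin
  scaled (suc n) e                         ≡⟨ scaled-+ 1 n e ⟩
  scaled 1 e ℚ.+ scaled n e                ≡⟨ cong (ℚ._+ scaled n e) (scaled-1 e) ⟩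
  half^ e ℚ.+ scaled n e                   ≡⟨ ℚₚ.+-comm (half^ e) _ ⟩
  scaled n e ℚ.+ half^ e                   ∎
  where open ≡-Reasoning

-- Doubling and halving natural numbers.

double : ∀ n → 2 * n ≡ n + n
double n = cong (_+_ n) (ℕₚ.+-identityʳ n)

scaled-2^ : ∀ e → scaled (2 ^ e) e ≡ 1ℚ
scaled-2^ zero    = scaled-1 0
scaled-2^ (suc e) rewrite double (2 ^ e) = trans (scaled-double (2 ^ e) e) (scaled-2^ e)

2^>0 : ∀ n → 0 < 2 ^ n
2^>0 n = ℕₚ.m^n>0 2 n

parity : ∀ t → ∃ λ h → t ≡ h + h ⊎ t ≡ suc (h + h)
parity zero    = 0 , inj₁ refl
parity (suc t) with parity t
... | h , inj₁ refl = h , inj₂ refl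
... | h , inj₂ refl = suc h , inj₁ (cong suc (sym (ℕₚ.+-suc h h)))

-- The `suc` makes one lemma serve both even and odd right-hand sides.
halve-≤ : ∀ {x y} → x + x ≤ suc (y + y) → x ≤ y
halve-≤ {x} {y} 2x≤1+2y = ℕₚ.≮⇒≥ λ y<x →
  ℕₚ.1+n≰n (ℕₚ.≤-trans (subst (_≤ x + x) (cong suc (ℕₚ.+-suc y y)) (ℕₚ.+-mono-≤ y<x y<x)) 2x≤1+2y)

halve-< : ∀ {x y} → x + x < 2 * y → x < y
halve-< {x} {y} lt = ℕₚ.*-cancelˡ-< 2 x y (subst (_< 2 * y) (sym (double x)) lt)

-- Sets of prescribed weight: antichain property and counting.

AtLeast-≤ : ∀ {F n k l} → l ≤ k → AtLeast F n k → AtLeast F n l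
AtLeast-≤ {l = l} l≤k (L , uniq , refl , all) =
  take l L , Uniqueₚ.take⁺ l uniq , trans (Listₚ.length-take l L) (ℕₚ.m≤n⇒m⊓n≡m l≤k) , Allₚ.take⁺ l all

InRange-suc : ∀ {n A} → InRange n A → InRange (suc n) A
InRange-suc = All.map λ (1≤x , x≤n) → 1≤x , ℕₚ.m≤n⇒m≤1+n x≤n

AtLeast-suc : ∀ {F n k} → AtLeast F n k → AtLeast F (suc n) k
AtLeast-suc (L , uniq , len , all) =
  L , uniq , len , All.map (λ (A∈F , A⊆[n]) → A∈F , InRange-suc A⊆[n]) all

⊆-tail : ∀ {A b B} → All (b <_) A → A ⊆ b ∷ B → A ⊆ B
⊆-tail b<A A⊆bB x∈A with A⊆bB x∈A
... | here refl = contradiction (All.lookup b<A x∈A) (ℕₚ.<-irrefl refl)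
... | there x∈B = x∈B

module Weighted (w : ℕ → ℚ) (w-positive : ∀ i → ℚ.Positive (w i)) where

  weight : List ℕ → ℚ
  weight []       = 0ℚ
  weight (x ∷ xs) = w x ℚ.+ weight xs

  Level : ℚ → Family
  Level q A = IsFinSubset A × weight A ≡ q

  w>0 : ∀ i → 0ℚ ℚ.< w i
  w>0 i = ℚₚ.positive⁻¹ (w i) {{w-positive i}}

  weight<weight-∷ : ∀ x xs → weight xs ℚ.< weight (x ∷ xs)
  weight<weight-∷ x xs =
    subst (ℚ._< weight (x ∷ xs)) (ℚₚ.+-identityˡ (weight xs)) (ℚₚ.+-monoˡ-< (weight xs) (w>0 x))

  weight-∷ʳ : ∀ xs x → weight (xs ∷ʳ x) ≡ weight xs ℚ.+ w x
  weight-∷ʳ []       x = ℚₚ.+-comm (w x) 0ℚ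
  weight-∷ʳ (y ∷ ys) x = trans (cong (w y ℚ.+_) (weight-∷ʳ ys x)) (sym (ℚₚ.+-assoc (w y) (weight ys) (w x)))

  -- Compare the least elements `a` and `b`. Equal heads cancel; `a < b` is impossible, as `a` would
  -- be missing from `b ∷ B`; if `b < a`, then `A` already lies in the tail `B`, and the positive
  -- weight of `b` makes the inequality strict. The recursion descends on `B`.
  ⊆⇒≡⊎weight< : ∀ {A B} → IsFinSubset A → IsFinSubset B → A ⊆ B → A ≡ B ⊎ weight A ℚ.< weight B
  ⊆⇒weight<weight-∷ : ∀ {A b B} → IsFinSubset A → IsFinSubset B → A ⊆ B → weight A ℚ.< weight (b ∷ B)

  ⊆⇒≡⊎weight< {[]}    {[]}    _ _ _ = inj₁ refl
  ⊆⇒≡⊎weight< {[]}    {_ ∷ _} A-fin (_ ∷ B< , _ ∷ B≥1) _ =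
    inj₂ (⊆⇒weight<weight-∷ A-fin (B< , B≥1) λ ())
  ⊆⇒≡⊎weight< {_ ∷ _} {[]}    _ _ A⊆B = contradiction (A⊆B (here refl)) λ ()
  ⊆⇒≡⊎weight< {a ∷ A} {b ∷ B} A-fin@(a<A ∷ A< , _ ∷ A≥1) (b<B ∷ B< , _ ∷ B≥1) A⊆B with ℕₚ.<-cmp a b
  ... | tri< a<b a≢b _ = contradiction (A⊆B (here refl)) λ where
    (here a≡b)  → a≢b a≡b
    (there a∈B) → ℕₚ.<-asym a<b (All.lookup b<B a∈B)
  ... | tri≈ _ refl _ = Sum.map (cong (a ∷_)) (ℚₚ.+-monoʳ-< (w a))
    (⊆⇒≡⊎weight< (A< , A≥1) (B< , B≥1) (⊆-tail a<A (A⊆B ∘ there)))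
  ... | tri> _ _ b<a =
    inj₂ (⊆⇒weight<weight-∷ A-fin (B< , B≥1) (⊆-tail (b<a ∷ All.map (ℕₚ.<-trans b<a) a<A) A⊆B))

  ⊆⇒weight<weight-∷ {b = b} {B} A-fin B-fin A⊆B with ⊆⇒≡⊎weight< A-fin B-fin A⊆B
  ... | inj₁ refl = weight<weight-∷ b B
  ... | inj₂ lt   = ℚₚ.<-trans lt (weight<weight-∷ b B)

  Level-antichain : ∀ q → Antichain (Level q)
  Level-antichain q A B (A-fin , refl) (B-fin , wB≡wA) A⊆B =
    [ id , (λ lt → contradiction lt (ℚₚ.<-irrefl (sym wB≡wA))) ]′ (⊆⇒≡⊎weight< A-fin B-fin A⊆B)

  private
    Member : ℚ → ℕ → List ℕ → Set
    Member q n A = Level q A × InRange n A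

    Member-∷ʳ : ∀ {q n A} → Member q n A → Member (q ℚ.+ w (suc n)) (suc n) (A ∷ʳ suc n)
    Member-∷ʳ {n = n} {A} (((A< , A≥1) , refl) , A⊆[n]) =
      ( ( AllPairsₚ.++⁺ A< ([] ∷ []) (All.map (λ (_ , x≤n) → s≤s x≤n ∷ []) A⊆[n])
        , Allₚ.++⁺ A≥1 (s≤s z≤n ∷ []))
      , weight-∷ʳ A (suc n))
      , Allₚ.++⁺ (InRange-suc A⊆[n]) ((s≤s z≤n , ℕₚ.≤-refl) ∷ [])

  AtLeast-insert : ∀ n q {k} → AtLeast (Level q) n k → AtLeast (Level (q ℚ.+ w (suc n))) (suc n) k
  AtLeast-insert n _ (L , uniq , len , all) =
    map (_∷ʳ suc n) L
    , Uniqueₚ.map⁺ (λ {A} {B} → Listₚ.∷ʳ-injectiveˡ A B) uniq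
    , trans (Listₚ.length-map _ L) len
    , Allₚ.map⁺ (All.map Member-∷ʳ all)

  AtLeast-insert-or-not : ∀ n q {k l} → AtLeast (Level (q ℚ.+ w (suc n))) n k → AtLeast (Level q) n l →
    AtLeast (Level (q ℚ.+ w (suc n))) (suc n) (k + l)
  AtLeast-insert-or-not n q (L , uniqL , lenL , allL) atLeast@(M , _) =
    let _ , uniq , len , all = AtLeast-insert n q atLeast in
    L ++ map (_∷ʳ suc n) M
    , Uniqueₚ.++⁺ uniqL uniq disjoint
    , trans (Listₚ.length-++ L) (cong₂ _+_ lenL len)
    , Allₚ.++⁺ (All.map (λ (A∈ , A⊆[n]) → A∈ , InRange-suc A⊆[n]) allL) all
    where
    disjoint : Disjoint L (map (_∷ʳ suc n) M)
    disjoint (A∈L , A∈M) with ∈ₚ.∈-map⁻ (_∷ʳ suc n) A∈M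
    ... | B , _ , refl =
      -- A set containing `suc n` is not inside [n].
      ℕₚ.1+n≰n (proj₂ (All.lookup (proj₂ (All.lookup allL A∈L)) (∈ₚ.∈-++⁺ʳ B (here refl))))

-- Digits, free elements and binary expansions.

-- free n tells whether the element suc n is free.
module Counting (free : ℕ → Bool) where

  k b : ℕ → ℕ
  k zero    = 0
  k (suc n) = if free n then suc (k n) else k n
  b zero    = 0
  b (suc n) = if free n then b n else suc (b n)

  -- 2^(b n) times the total weight of the free elements of [n].
  P : ℕ → ℕ
  P zero    = 0
  P (suc n) = if free n then suc (P n) else P n + P n

  open Weighted (half^ ∘ b) (half^-positive ∘ b) public

  b+k≡n : ∀ n → b n + k n ≡ n
  b+k≡n zero = refl
  b+k≡n (suc n) with free n
  ... | true  = trans (ℕₚ.+-suc (b n) (k n)) (cong suc (b+k≡n n))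
  ... | false = cong suc (b+k≡n n)

  -- Let `s` be the weight of a set of free elements of [n]. The bounds on `t` put `t / 2^(b n) - s`
  -- in [0,1), and its `b n` binary places say which digits to add. So each of the `2 ^ k n` sets of
  -- free elements yields a member.
  level-count : ∀ n t → P n ≤ t → t < 2 ^ b n → AtLeast (Level (scaled t (b n))) n (2 ^ k n)
  level-count zero zero _ _ = [] ∷ [] , [] ∷ [] , refl , ((([] , []) , sym (scaled-0 0)) , []) ∷ []
  level-count zero (suc t) _ (s≤s ())
  -- Both are abstracted before the split on `free n`, so that the weight `half^ (b (suc n))` in
  -- their types reduces with it.
  level-count (suc n) t P≤t t<2^b with AtLeast-insert-or-not n | AtLeast-insert n
  ... | both | insert with free n
  -- A free `suc n` weighs one unit `half^ (b n)`: sets avoiding it need `suc t` units from [n],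
  -- sets containing it need `t`.
  level-count (suc n) (suc t) (s≤s P≤t) t<2^b | both | _ | true
    rewrite double (2 ^ k n) | scaled-suc t (b n) =
    both _ (subst (λ q → AtLeast (Level q) n (2 ^ k n)) (scaled-suc t (b n))
           (level-count n (suc t) (ℕₚ.m≤n⇒m≤1+n P≤t) t<2^b))
         (level-count n t P≤t (ℕₚ.<-trans (ℕₚ.n<1+n t) t<2^b))
  -- The digit `suc n` is the new last binary place, so it is used exactly when `t` is odd; `h`
  -- units of twice the size remain.
  level-count (suc n) t P≤t t<2^b | _ | insert | false with parity t
  ... | h , inj₁ refl rewrite scaled-double h (b n) =
    AtLeast-suc (level-count n h (halve-≤ (ℕₚ.m≤n⇒m≤1+n P≤t)) (halve-< t<2^b))
  ... | h , inj₂ refl rewrite scaled-suc (h + h) (suc (b n)) | scaled-double h (b n) =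
    insert _ (level-count n h (halve-≤ P≤t) (halve-< (ℕₚ.<-trans (ℕₚ.n<1+n (h + h)) t<2^b)))

  -- Weight 1 is `2 ^ b n` units, just beyond the range of `level-count`. The one set lost is that
  -- without free elements, because the digits in [n] alone weigh less than 1.
  level-1-count : ∀ n → P n ≤ 2 ^ b n → AtLeast (Level 1ℚ) n (2 ^ k n ∸ 1)
  level-1-count zero _ = [] , [] , refl , []
  level-1-count (suc n) P≤2^b with AtLeast-insert-or-not n
  ... | both with free n
  -- Sets containing the free `suc n` need weight `1 - half^ (b n)` from [n]. This is below 1, so
  -- `level-count` supplies all `2 ^ k n` of them.
  ... | true = AtLeast-≤ (ℕₚ.≤-reflexive count)
    (subst (λ q → AtLeast (Level q) (suc n) (2 ^ k n ∸ 1 + 2 ^ k n)) split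
      (both _ (subst (λ q → AtLeast (Level q) n (2 ^ k n ∸ 1)) (sym split) (level-1-count n (ℕₚ.<⇒≤ P≤2^b)))
            (level-count n t (ℕₚ.≤-pred (subst (suc (P n) ≤_) (sym 1+t≡2^b) P≤2^b))
              (ℕₚ.≤-reflexive 1+t≡2^b))))
    where
    t : ℕ
    t = 2 ^ b n ∸ 1
    1+t≡2^b : suc t ≡ 2 ^ b n
    1+t≡2^b = ℕₚ.m+[n∸m]≡n (2^>0 (b n))
    split : scaled t (b n) ℚ.+ half^ (b n) ≡ 1ℚ
    split = trans (sym (scaled-suc t (b n)))
      (trans (cong (λ m → scaled m (b n)) 1+t≡2^b) (scaled-2^ (b n)))
    count : 2 * 2 ^ k n ∸ 1 ≡ 2 ^ k n ∸ 1 + 2 ^ k n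
    count = trans (cong (_∸ 1) (double (2 ^ k n))) (ℕₚ.+-∸-comm (2 ^ k n) (2^>0 (k n)))
  ... | false = AtLeast-suc (level-1-count n
    (halve-≤ (ℕₚ.m≤n⇒m≤1+n (subst (P n + P n ≤_) (double (2 ^ b n)) P≤2^b))))

-- The greedy choice of free elements.

module Greedy (f : ℕ → ℕ) where

  private
    -- κ is the function k below, which itself needs free.
    κ : ℕ → ℕ
    κ zero    = 0
    κ (suc n) = if does (2 ^ κ n ≤? f (suc n)) then suc (κ n) else κ n

  free : ℕ → Bool
  free n = does (2 ^ κ n ≤? f (suc n))

  open Counting free public

  κ≡k : ∀ n → κ n ≡ k n
  κ≡k zero    = refl
  κ≡k (suc n) = cong (λ m → if free n then suc m else m) (κ≡k n)

  -- `free n` is computed from `κ`, so comparing with `k n` does not reduce it; the equations let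
  -- `rewrite` do so.
  free? : ∀ n → 2 ^ k n ≤ f (suc n) × free n ≡ true ⊎ f (suc n) < 2 ^ k n × free n ≡ false
  free? n with 2 ^ k n ≤? f (suc n) | cong (λ m → does (2 ^ m ≤? f (suc n))) (κ≡k n)
  ... | yes le | eq = inj₁ (le , trans eq (dec-true (2 ^ k n ≤? f (suc n)) le))
  ... | no  ≰  | eq = inj₂ (ℕₚ.≰⇒> ≰ , trans eq (dec-false (2 ^ k n ≤? f (suc n)) ≰))

  -- If `suc n` is a digit, this is the failed test. If it is free, `2 ^ k n` doubles, while
  -- `f n + 1` at most doubles.
  f<2^k : f 0 ≡ 0 → (∀ n → f (suc n) ≤ suc (f n + f n)) → ∀ n → f n < 2 ^ k n
  f<2^k f0≡0 f-growth zero = subst (_< 1) (sym f0≡0) (s≤s z≤n)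
  f<2^k f0≡0 f-growth (suc n) with free? n
  ... | inj₂ (lt , eq) rewrite eq = lt
  ... | inj₁ (_  , eq) rewrite eq = begin-strict
    f (suc n)              <⟨ s≤s (f-growth n) ⟩
    suc (suc (f n + f n))  ≡⟨ cong suc (ℕₚ.+-suc (f n) (f n)) ⟨
    suc (f n) + suc (f n)  ≤⟨ ℕₚ.+-mono-≤ ih ih ⟩
    2 ^ k n + 2 ^ k n      ≡⟨ double (2 ^ k n) ⟨
    2 * 2 ^ k n            ∎
    where
    open ℕₚ.≤-Reasoning
    ih : f n < 2 ^ k n
    ih = f<2^k f0≡0 f-growth n

  -- `2 ^ n` times the sum of `f i / 2^i` over `i ≤ n`.
  Q : ℕ → ℕ
  Q zero    = f 0
  Q (suc n) = Q n + Q n + f (suc n)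

  scaled-Q : ∀ n → scaled (Q n) n ≡ partialSum (term f) 0 (suc n)
  scaled-Q zero    = trans (scaled-term f 0) (sym (ℚₚ.+-identityʳ (term f 0)))
  scaled-Q (suc n) = begin
    scaled (Q n + Q n + f (suc n)) (suc n)                      ≡⟨ scaled-+ (Q n + Q n) (f (suc n)) (suc n) ⟩
    scaled (Q n + Q n) (suc n) ℚ.+ scaled (f (suc n)) (suc n)   ≡⟨ cong₂ ℚ._+_ (scaled-double (Q n) n) (scaled-term f (suc n)) ⟩
    scaled (Q n) n ℚ.+ term f (suc n)                           ≡⟨ cong (ℚ._+ term f (suc n)) (scaled-Q n) ⟩
    partialSum (term f) 0 (suc n) ℚ.+ term f (suc n)            ≡⟨ ℚₚ.+-comm _ (term f (suc n)) ⟩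
    partialSum (term f) 0 (suc (suc n))                         ∎
    where open ≡-Reasoning

  4Q≤2^ : (∀ m → partialSum (term f) 0 m ℚ.≤ + 1 / 4) → ∀ n → (Q n + Q n) + (Q n + Q n) ≤ 2 ^ n
  4Q≤2^ sum≤¼ n = scaled-cancel-≤ n (begin
    scaled ((Q n + Q n) + (Q n + Q n)) n
      ≡⟨ scaled-+ (Q n + Q n) (Q n + Q n) n ⟩
    scaled (Q n + Q n) n ℚ.+ scaled (Q n + Q n) n
      ≡⟨ cong (λ x → x ℚ.+ x) (trans (scaled-+ (Q n) (Q n) n) (cong (λ x → x ℚ.+ x) (scaled-Q n))) ⟩
    (S ℚ.+ S) ℚ.+ (S ℚ.+ S)
      ≤⟨ ℚₚ.+-mono-≤ 2S≤½ 2S≤½ ⟩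
    1ℚ
      ≡⟨ scaled-2^ n ⟨
    scaled (2 ^ n) n
      ∎)
    where
    open ℚₚ.≤-Reasoning
    S : ℚ
    S = partialSum (term f) 0 (suc n)
    2S≤½ : S ℚ.+ S ℚ.≤ ½
    2S≤½ = ℚₚ.+-mono-≤ (sum≤¼ (suc n)) (sum≤¼ (suc n))

  -- Divided by `2 ^ n`, it bounds the weight of the free elements by twice the partial sum. Each
  -- step doubles both sides; a free `suc n` then adds `2 * 2 ^ k n` on the left, at most the
  -- `2 * f (suc n)` added on the right.
  P*2^k≤2Q : ∀ n → P n * 2 ^ k n ≤ Q n + Q n
  P*2^k≤2Q zero = z≤n
  P*2^k≤2Q (suc n) with free? n
  ... | inj₁ (2^k≤f , eq) rewrite eq = begin
    suc (P n) * (2 * 2 ^ k n)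
      ≡⟨ solve 2 (λ p x → (con 1 :+ p) :* (con 2 :* x) := (p :* x :+ x) :+ (p :* x :+ x)) refl (P n) (2 ^ k n) ⟩
    (P n * 2 ^ k n + 2 ^ k n) + (P n * 2 ^ k n + 2 ^ k n)
      ≤⟨ ℕₚ.+-mono-≤ half half ⟩
    Q (suc n) + Q (suc n)
      ∎
    where
    open ℕₚ.≤-Reasoning
    open +-*-Solver
    half : P n * 2 ^ k n + 2 ^ k n ≤ Q (suc n)
    half = ℕₚ.+-mono-≤ (P*2^k≤2Q n) 2^k≤f
  ... | inj₂ (_ , eq) rewrite eq = begin
    (P n + P n) * 2 ^ k n              ≡⟨ ℕₚ.*-distribʳ-+ (2 ^ k n) (P n) (P n) ⟩
    P n * 2 ^ k n + P n * 2 ^ k n      ≤⟨ ℕₚ.+-mono-≤ half half ⟩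
    Q (suc n) + Q (suc n)              ∎
    where
    open ℕₚ.≤-Reasoning
    half : P n * 2 ^ k n ≤ Q (suc n)
    half = ℕₚ.≤-trans (P*2^k≤2Q n) (ℕₚ.m≤m+n (Q n + Q n) (f (suc n)))

  P≤2^b : (∀ m → partialSum (term f) 0 m ℚ.≤ + 1 / 4) → ∀ n → P n ≤ 2 ^ b n
  P≤2^b sum≤¼ n = ℕₚ.*-cancelʳ-≤ (P n) (2 ^ b n) (2 ^ k n) {{ℕₚ.m^n≢0 2 (k n)}} (begin
    P n * 2 ^ k n                    ≤⟨ P*2^k≤2Q n ⟩
    Q n + Q n                        ≤⟨ ℕₚ.m≤m+n (Q n + Q n) (Q n + Q n) ⟩
    (Q n + Q n) + (Q n + Q n)        ≤⟨ 4Q≤2^ sum≤¼ n ⟩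
    2 ^ n                            ≡⟨ cong (2 ^_) (b+k≡n n) ⟨
    2 ^ (b n + k n)                  ≡⟨ ℕₚ.^-distribˡ-+-* 2 (b n) (k n) ⟩
    2 ^ b n * 2 ^ k n                ∎)
    where open ℕₚ.≤-Reasoning

  level-1-count≥f : f 0 ≡ 0 → (∀ n → f (suc n) ≤ suc (f n + f n)) →
    (∀ m → partialSum (term f) 0 m ℚ.≤ + 1 / 4) → ∀ n → AtLeast (Level 1ℚ) n (f n)
  level-1-count≥f f0≡0 f-growth sum≤¼ n =
    AtLeast-≤ (ℕₚ.∸-monoˡ-≤ 1 (f<2^k f0≡0 f-growth n)) (level-1-count n (P≤2^b sum≤¼ n))

-- Extension of the sequence by zero.

module Cutoff (n₀ : ℕ) (f : ℕ → ℕ) where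

  -- The zeros turn every element below `n₀` into a digit, since `2 ^ k n ≤ 0` fails, and let sums
  -- start at 0.
  cutoff : ℕ → ℕ
  cutoff n = if does (n₀ ≤? n) then f n else 0

  cutoff-≥ : ∀ {n} → n₀ ≤ n → cutoff n ≡ f n
  cutoff-≥ {n} n₀≤n = cong (if_then f n else 0) (dec-true (n₀ ≤? n) n₀≤n)

  cutoff-< : ∀ {n} → n < n₀ → cutoff n ≡ 0
  cutoff-< {n} n<n₀ = cong (if_then f n else 0) (dec-false (n₀ ≤? n) (ℕₚ.<⇒≱ n<n₀))

  sum-≤n₀ : ∀ m → m ≤ n₀ → partialSum (term cutoff) 0 m ≡ 0ℚ
  sum-≤n₀ zero    _    = refl
  sum-≤n₀ (suc m) m<n₀ rewrite cutoff-< m<n₀ | sum-≤n₀ m (ℕₚ.<⇒≤ m<n₀) =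
    trans (ℚₚ.+-identityʳ _) (ℚₚ.*-zeroˡ (half^ m))

  sum-n₀+ : ∀ j → partialSum (term cutoff) 0 (n₀ + j) ≡ partialSum (term f) n₀ j
  sum-n₀+ zero    rewrite ℕₚ.+-identityʳ n₀ = sum-≤n₀ n₀ ℕₚ.≤-refl
  sum-n₀+ (suc j) rewrite ℕₚ.+-suc n₀ j | cutoff-≥ (ℕₚ.m≤m+n n₀ j) =
    cong (term f (n₀ + j) ℚ.+_) (sum-n₀+ j)

  sum-bounded : ∀ {q} → (∀ j → partialSum (term f) n₀ j ℚ.≤ q) → ∀ m → partialSum (term cutoff) 0 m ℚ.≤ q
  sum-bounded {q} bound m with ℕₚ.≤-total m n₀
  -- `bound 0`, about the empty sum, says `0ℚ ≤ q`.
  ... | inj₁ m≤n₀ = subst (ℚ._≤ q) (sym (sum-≤n₀ m m≤n₀)) (bound 0)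
  ... | inj₂ n₀≤m = subst (ℚ._≤ q)
    (trans (sym (sum-n₀+ (m ∸ n₀))) (cong (partialSum (term cutoff) 0) (ℕₚ.m+[n∸m]≡n n₀≤m)))
    (bound (m ∸ n₀))

  -- The extra 1 in the bound accommodates the jump from 0 to `f n₀ ≡ 1`.
  cutoff-growth : f n₀ ≡ 1 → (∀ n → n₀ ≤ n → f (suc n) ≤ f n + f n) →
    ∀ n → cutoff (suc n) ≤ suc (cutoff n + cutoff n)
  cutoff-growth f-start f-growth n with ℕₚ.<-cmp (suc n) n₀
  ... | tri< 1+n<n₀ _ _ rewrite cutoff-< 1+n<n₀ = z≤n
  ... | tri≈ _ refl _ rewrite cutoff-≥ {suc n} ℕₚ.≤-refl | f-start = s≤s z≤n
  ... | tri> _ _ (s≤s n₀≤n) rewrite cutoff-≥ n₀≤n | cutoff-≥ (ℕₚ.m≤n⇒m≤1+n n₀≤n) =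
    ℕₚ.m≤n⇒m≤1+n (f-growth n n₀≤n)

-- Growth of the sequence and conclusion.

term-≤⇒≤-double : ∀ f n → term f (suc n) ℚ.≤ term f n → f (suc n) ≤ f n + f n
term-≤⇒≤-double f n le =
  scaled-cancel-≤ (suc n) (begin
    scaled (f (suc n)) (suc n)     ≡⟨ scaled-term f (suc n) ⟩
    term f (suc n)                 ≤⟨ le ⟩
    term f n                       ≡⟨ scaled-term f n ⟨
    scaled (f n) n                 ≡⟨ scaled-double (f n) n ⟨
    scaled (f n + f n) (suc n)     ∎)
  where open ℚₚ.≤-Reasoning

theorem3 : (n₀ : ℕ) → 1 ≤ n₀ → (f : ℕ → ℕ) →
    (∀ n → n₀ ≤ n → 1 ≤ f n) →
    (∀ n → n₀ ≤ n → f n ≤ f (suc n)) →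
    f n₀ ≡ 1 →
    (∀ k → partialSum (term f) n₀ k ℚ.≤ (+ 1 / 4)) →
    (∀ n → n₀ ≤ n → term f (suc n) ℚ.≤ term f n) →
    Σ Family λ F → WellFormed F × Antichain F × (∀ n → n₀ ≤ n → AtLeast F n (f n))
theorem3 n₀ 1≤n₀ f _ _ f-start sum≤¼ term-noninc =
  Level 1ℚ
  , (λ _ → proj₁)
  , Level-antichain 1ℚ
  , λ n n₀≤n → subst (AtLeast (Level 1ℚ) n) (cutoff-≥ n₀≤n)
      -- As `1 ≤ n₀`, the index 0 lies below the cutoff; this starts the induction of `f<2^k`.
      (level-1-count≥f (cutoff-< 1≤n₀)
        (cutoff-growth f-start λ m n₀≤m → term-≤⇒≤-double f m (term-noninc m n₀≤m))
        (sum-bounded sum≤¼) n)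
  where
  open Cutoff n₀ f
  open Greedy cutoff
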